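{- Let $G$ be a graph and let $H = K_1 + G$ be the join of a single new node with $G$ (the new node adjacent to every node of $G$). If $H$ is non-graceful, then $G$ is non-supergraceful.
   Context: Graphs are finite, simple. A graceful labeling of a graph with $q$ edges is an injective map $\varphi: V \to \{0,\dots,q\}$ whose induced edge labels $|\varphi(u)-\varphi(v)|$ are pairwise distinct; a graph is graceful if it has one, non-graceful otherwise. For a graph $G$ with $p$ nodes and $q$ edges, a total labeling is a map $\varphi: V(G) \to \{1,\dots,p+q\}$ such that the $p$ node labels $\varphi(u)$ and the $q$ edge labels $|\varphi(u)-\varphi(v)|$, $uv \in E(G)$, are all pairwise distinct, so that together they form exactly $\{1,\dots,p+q\}$. $G$ is supergraceful if it admits a total labeling, and non-supergraceful otherwise. -}

module Defs where

open import Data.Fin.Base using (Fin; splitAt)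
  renaming (_<_ to _<ᶠ_)
open import Data.Fin.Properties using (_≟_) renaming (_<?_ to _<ᶠ?_)
open import Data.List.Base
  using (List; allFin; cartesianProduct; filter; length; map; _++_)
open import Data.List.Relation.Unary.Unique.Propositional using (Unique)
open import Data.Nat.Base using (ℕ; _+_; _≤_; ∣_-_∣)
open import Data.Product.Base using (_×_; _,_; ∃)
open import Data.Sum.Base using (_⊎_; inj₁; inj₂)
open import Data.Unit.Base using (⊤; tt)
open import Function.Base using (_on_)
open import Function.Definitions using (Injective)
open import Level using (0ℓ)
open import Relation.Binary.Core using (Rel)
open import Relation.Binary.Definitions using (Decidable; Irreflexive; Symmetric)
open import Relation.Binary.PropositionalEquality
  using (_≡_; _≢_; refl; ≢-sym)
open import Relation.Nullary.Decidable using (yes; no; _×-dec_; ¬?)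
open import Relation.Nullary.Negation.Core using (¬_)

record Graph (p : ℕ) : Set₁ where
  infix 4 _~_ _~?_
  field
    _~_      : Rel (Fin p) 0ℓ
    _~?_     : Decidable _~_
    ~-sym    : Symmetric _~_
    ~-irrefl : Irreflexive _≡_ _~_

-- Each edge uv is listed exactly once, as the pair (u , v) with u < v.
edges : ∀ {p} → Graph p → List (Fin p × Fin p)
edges {p} G =
  filter (λ (u , v) → (u <ᶠ? v) ×-dec (u ~? v))
         (cartesianProduct (allFin p) (allFin p))
  where open Graph G

size : ∀ {p} → Graph p → ℕ
size G = length (edges G)

complete : ∀ p → Graph p
complete p = record
  { _~_      = _≢_
  ; _~?_     = λ u v → ¬? (u ≟ v)
  ; ~-sym    = ≢-sym
  ; ~-irrefl = λ u≡v u≢v → u≢v u≡v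
  }

K₁ : Graph 1
K₁ = complete 1

module Join {m n} (G : Graph m) (H : Graph n) where
  private
    module G = Graph G
    module H = Graph H

  Adj : Rel (Fin m ⊎ Fin n) 0ℓ
  Adj (inj₁ u) (inj₁ v) = u G.~ v
  Adj (inj₁ _) (inj₂ _) = ⊤
  Adj (inj₂ _) (inj₁ _) = ⊤
  Adj (inj₂ u) (inj₂ v) = u H.~ v

  adj? : Decidable Adj
  adj? (inj₁ u) (inj₁ v) = u G.~? v
  adj? (inj₁ _) (inj₂ _) = yes tt
  adj? (inj₂ _) (inj₁ _) = yes tt
  adj? (inj₂ u) (inj₂ v) = u H.~? v

  adj-sym : Symmetric Adj
  adj-sym {inj₁ _} {inj₁ _} = G.~-sym
  adj-sym {inj₁ _} {inj₂ _} _ = tt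
  adj-sym {inj₂ _} {inj₁ _} _ = tt
  adj-sym {inj₂ _} {inj₂ _} = H.~-sym

  adj-irrefl : ∀ x → ¬ Adj x x
  adj-irrefl (inj₁ _) = G.~-irrefl refl
  adj-irrefl (inj₂ _) = H.~-irrefl refl

-- In Fin (m + n), the first m nodes are those of G and the last n those of H.
join : ∀ {m n} → Graph m → Graph n → Graph (m + n)
join {m} G H = record
  { _~_      = Adj on splitAt m
  ; _~?_     = λ u v → adj? (splitAt m u) (splitAt m v)
  ; ~-sym    = λ {u} {v} → adj-sym {splitAt m u} {splitAt m v}
  ; ~-irrefl = λ { {u} refl → adj-irrefl (splitAt m u) }
  }
  where open Join G H

edgeLabel : ∀ {p} → (Fin p → ℕ) → Fin p × Fin p → ℕ
edgeLabel φ (u , v) = ∣ φ u - φ v ∣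

record IsGracefulLabeling {p} (G : Graph p) (φ : Fin p → ℕ) : Set where
  field
    bounded   : ∀ u → φ u ≤ size G
    injective : Injective _≡_ _≡_ φ
    distinct  : Unique (map (edgeLabel φ) (edges G))

Graceful : ∀ {p} → Graph p → Set
Graceful G = ∃ (IsGracefulLabeling G)

record IsTotalLabeling {p} (G : Graph p) (φ : Fin p → ℕ) : Set where
  field
    positive : ∀ u → 1 ≤ φ u
    bounded  : ∀ u → φ u ≤ p + size G
    distinct : Unique (map φ (allFin p) ++ map (edgeLabel φ) (edges G))

Supergraceful : ∀ {p} → Graph p → Set
Supergraceful G = ∃ (IsTotalLabeling G)

{-# OPTIONS --safe #-}

-- Extend a total labeling φ of G by giving the new node the label 0. The edge
-- from it to u then gets the label φ u, so the edge labels of K₁ + G are exactly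
-- the node and edge labels of φ, and K₁ + G has p + q edges: the extension is
-- a graceful labeling.
module Submission where

open import Defs
open import Data.Bool.Base using (true; false)
open import Data.Fin.Base using (Fin; zero; suc)
open import Data.Fin.Properties using () renaming (_<?_ to _<ᶠ?_)
open import Data.List.Base
  using (List; []; _∷_; allFin; cartesianProduct; filter; length; map; tabulate; _++_)
open import Data.List.Membership.Propositional using (_∈_)
open import Data.List.Membership.Propositional.Properties using (∈-allFin)
open import Data.List.Properties
  using (filter-++; filter-all; length-++; length-map; length-tabulate; map-++; map-tabulate; map-∘)
open import Data.List.Relation.Unary.All using (lookup)
open import Data.List.Relation.Unary.All.Properties using (++⁻ˡ; map⁺; map⁻; tabulate⁺)
open import Data.List.Relation.Unary.AllPairs using ([]; _∷_)
open import Data.List.Relation.Unary.Any using (here; there)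
open import Data.List.Relation.Unary.Unique.Propositional using (Unique)
open import Data.Nat.Base using (ℕ; zero; suc; _+_; _≤_; z≤n; z<s)
open import Data.Nat.Properties using (n≮0; ≤-trans; ≤-reflexive)
open import Data.Product.Base using (_×_; _,_) renaming (map to map×)
open import Data.Unit.Base using (tt)
open import Data.Vec.Functional using () renaming (_∷_ to _∷ᶠ_)
open import Function.Base using (id)
open import Function.Definitions using (Injective)
open import Level using (Level)
open import Relation.Binary.PropositionalEquality
  using (_≡_; refl; sym; trans; cong; cong₂; subst; module ≡-Reasoning)
open import Relation.Nullary.Decidable using (does; _×-dec_)
open import Relation.Nullary.Negation.Core using (¬_; contradiction)
open import Relation.Unary using (Pred; Decidable)

private
  variable
    a b p q : Level
    A : Set a
    B : Set b

-- Comparing only the Booleans `does` makes the hypothesis hold by `refl` for `H-edge?` and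
-- `G-edge?`: the order test and the adjacency test on two successors both compute to those on the
-- original nodes.
filter-map : {P : Pred B p} {Q : Pred A q} (P? : Decidable P) (Q? : Decidable Q)
             (f : A → B) → (∀ x → does (P? (f x)) ≡ does (Q? x)) →
             ∀ xs → filter P? (map f xs) ≡ map f (filter Q? xs)
filter-map P? Q? f eq [] = refl
filter-map P? Q? f eq (x ∷ xs) with does (P? (f x)) | does (Q? x) | eq x
... | true  | _ | refl = cong (f x ∷_) (filter-map P? Q? f eq xs)
... | false | _ | refl = filter-map P? Q? f eq xs

Unique-++⁻ˡ : ∀ (xs : List A) {ys} → Unique (xs ++ ys) → Unique xs
Unique-++⁻ˡ []       _            = []
Unique-++⁻ˡ (x ∷ xs) (x∉ ∷ xsys!) = ++⁻ˡ xs x∉ ∷ Unique-++⁻ˡ xs xsys!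

-- Two different positions of `xs` with equal images would repeat an entry of `map f xs`, so both
-- membership proofs point to the same position.
Unique-map⇒injective-∈ : ∀ (f : A → B) {xs} → Unique (map f xs) →
                         ∀ {x y} → x ∈ xs → y ∈ xs → f x ≡ f y → x ≡ y
Unique-map⇒injective-∈ f _         (here refl) (here refl) _  = refl
Unique-map⇒injective-∈ f (x∉ ∷ _)  (here refl) (there y∈)  eq =
  contradiction eq (lookup (map⁻ x∉) y∈)
Unique-map⇒injective-∈ f (y∉ ∷ _)  (there x∈)  (here refl) eq =
  contradiction (sym eq) (lookup (map⁻ y∉) x∈)
Unique-map⇒injective-∈ f (_ ∷ xs!) (there x∈)  (there y∈)  eq =
  Unique-map⇒injective-∈ f xs! x∈ y∈ eq

module _ {n} (G : Graph n) where
  open ≡-Reasoning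

  private
    module G = Graph G
    module H = Graph (join K₁ G)

    G-edge? = λ ((u , v) : Fin n × Fin n) → (u <ᶠ? v) ×-dec (u G.~? v)
    H-edge? = λ ((u , v) : Fin (suc n) × Fin (suc n)) → (u <ᶠ? v) ×-dec (u H.~? v)

  -- Two independent lists allow induction on the first factor, the rows, while the second stays
  -- complete.
  filter-rim : ∀ xs ys →
    filter H-edge? (cartesianProduct (map suc xs) (zero ∷ map suc ys)) ≡
    map (map× suc suc) (filter G-edge? (cartesianProduct xs ys))
  filter-rim []       ys = refl
  filter-rim (x ∷ xs) ys = begin
    -- The first pair of the row, `(suc x , zero)`, has already been dropped by computation: it
    -- fails the order test.
    filter H-edge? (map (suc x ,_) (map suc ys) ++ rest)
      ≡⟨ filter-++ H-edge? (map (suc x ,_) (map suc ys)) rest ⟩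
    filter H-edge? (map (suc x ,_) (map suc ys)) ++ filter H-edge? rest
      ≡⟨ cong₂ _++_ row (filter-rim xs ys) ⟩
    map (map× suc suc) (filter G-edge? (map (x ,_) ys)) ++
    map (map× suc suc) (filter G-edge? (cartesianProduct xs ys))
      ≡⟨ map-++ (map× suc suc) (filter G-edge? (map (x ,_) ys)) _ ⟨
    map (map× suc suc) (filter G-edge? (map (x ,_) ys) ++ filter G-edge? (cartesianProduct xs ys))
      ≡⟨ cong (map (map× suc suc)) (filter-++ G-edge? (map (x ,_) ys) _) ⟨
    map (map× suc suc) (filter G-edge? (cartesianProduct (x ∷ xs) ys)) ∎
    where
    rest = cartesianProduct (map suc xs) (zero ∷ map suc ys)

    row : filter H-edge? (map (suc x ,_) (map suc ys)) ≡
          map (map× suc suc) (filter G-edge? (map (x ,_) ys))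
    row = begin
      filter H-edge? (map (suc x ,_) (map suc ys))
        -- Both double maps fuse to the map of `λ y → suc x , suc y`.
        ≡⟨ cong (filter H-edge?) (trans (sym (map-∘ ys)) (map-∘ ys)) ⟩
      filter H-edge? (map (map× suc suc) (map (x ,_) ys))
        ≡⟨ filter-map H-edge? G-edge? (map× suc suc) (λ _ → refl) (map (x ,_) ys) ⟩
      map (map× suc suc) (filter G-edge? (map (x ,_) ys)) ∎

  -- The row of the new node `zero` yields the spokes, the other rows the edges of `G`. This order
  -- matches that of the labels in `IsTotalLabeling`, so distinctness carries over without a
  -- permutation.
  edges-cone : edges (join K₁ G) ≡
               map (λ u → zero , suc u) (allFin n) ++ map (map× suc suc) (edges G)
  edges-cone = begin
    filter H-edge? (cartesianProduct (allFin (suc n)) (allFin (suc n)))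
      ≡⟨ cong (λ us → filter H-edge? (cartesianProduct (zero ∷ us) (zero ∷ us)))
              (map-tabulate id suc) ⟨
    -- The diagonal pair `(zero , zero)` disappears by computation.
    filter H-edge? (map (zero ,_) (map suc (allFin n)) ++ rest)
      ≡⟨ filter-++ H-edge? (map (zero ,_) (map suc (allFin n))) rest ⟩
    filter H-edge? (map (zero ,_) (map suc (allFin n))) ++ filter H-edge? rest
      ≡⟨ cong₂ _++_ spokes (filter-rim (allFin n) (allFin n)) ⟩
    map (λ u → zero , suc u) (allFin n) ++ map (map× suc suc) (edges G) ∎
    where
    rest = cartesianProduct (map suc (allFin n)) (zero ∷ map suc (allFin n))

    spokes : filter H-edge? (map (zero ,_) (map suc (allFin n))) ≡
             map (λ u → zero , suc u) (allFin n)
    spokes = trans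
      (cong (filter H-edge?) (sym (map-∘ (allFin n))))
      -- Adjacency across the join is `⊤`, and `zero` lies below every successor.
      (filter-all H-edge? (map⁺ (tabulate⁺ (λ _ → z<s , tt))))

  size-cone : size (join K₁ G) ≡ n + size G
  size-cone = begin
    length (edges (join K₁ G))
      ≡⟨ cong length edges-cone ⟩
    length (map (λ u → zero , suc u) (allFin n) ++ map (map× suc suc) (edges G))
      ≡⟨ length-++ (map _ (allFin n)) ⟩
    length (map (λ u → Fin.zero {n} , suc u) (allFin n)) + length (map (map× suc suc) (edges G))
      ≡⟨ cong₂ _+_ (trans (length-map _ (allFin n)) (length-tabulate id)) (length-map _ (edges G)) ⟩
    n + size G ∎

  edgeLabels-cone : ∀ (φ : Fin n → ℕ) →
    map (edgeLabel (0 ∷ᶠ φ)) (edges (join K₁ G)) ≡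
    map φ (allFin n) ++ map (edgeLabel φ) (edges G)
  edgeLabels-cone φ = begin
    map (edgeLabel (0 ∷ᶠ φ)) (edges (join K₁ G))
      ≡⟨ cong (map _) edges-cone ⟩
    map (edgeLabel (0 ∷ᶠ φ))
      (map (λ u → zero , suc u) (allFin n) ++ map (map× suc suc) (edges G))
      ≡⟨ map-++ _ (map _ (allFin n)) _ ⟩
    map (edgeLabel (0 ∷ᶠ φ)) (map (λ u → zero , suc u) (allFin n)) ++
    map (edgeLabel (0 ∷ᶠ φ)) (map (map× suc suc) (edges G))
      -- Fusing the maps is enough: `∣ 0 - φ u ∣` computes to `φ u`, and `0 ∷ᶠ φ` at `suc u` is
      -- `φ u`.
      ≡⟨ cong₂ _++_ (map-∘ (allFin n)) (map-∘ (edges G)) ⟨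
    map φ (allFin n) ++ map (edgeLabel φ) (edges G) ∎

  total⇒graceful-cone : ∀ {φ} → IsTotalLabeling G φ → IsGracefulLabeling (join K₁ G) (0 ∷ᶠ φ)
  total⇒graceful-cone {φ} total = record
    { bounded   = bounded′
    ; injective = injective′
    ; distinct  = subst Unique (sym (edgeLabels-cone φ)) distinct
    }
    where
    open IsTotalLabeling total

    bounded′ : ∀ u → (0 ∷ᶠ φ) u ≤ size (join K₁ G)
    bounded′ zero    = z≤n
    bounded′ (suc u) = ≤-trans (bounded u) (≤-reflexive (sym size-cone))

    φ-injective : Injective _≡_ _≡_ φ
    -- The node labels form the first block of the list of distinct labels.
    φ-injective = Unique-map⇒injective-∈ φ (Unique-++⁻ˡ (map φ (allFin n)) distinct)
                    (∈-allFin _) (∈-allFin _)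

    injective′ : Injective _≡_ _≡_ (0 ∷ᶠ φ)
    injective′ {zero}  {zero}  _  = refl
    -- Total labels start at 1, which leaves 0 free for the new node.
    injective′ {zero}  {suc v} eq = contradiction (subst (1 ≤_) (sym eq) (positive v)) n≮0
    injective′ {suc u} {zero}  eq = contradiction (subst (1 ≤_) eq (positive u)) n≮0
    injective′ {suc u} {suc v} eq = cong suc (φ-injective eq)

theorem7p3 : ∀ (n : ℕ) (G : Graph n) → ¬ Graceful (join K₁ G) → ¬ Supergraceful G
theorem7p3 n G nongraceful (φ , total) = nongraceful (0 ∷ᶠ φ , total⇒graceful-cone G total)
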